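{- For every fixed integer $k \ge 1$, there are only finitely many (up to isomorphism) $k$-vertex-critical $(P_5,W_4)$-free graphs.
   Context: All graphs are finite, simple and undirected. $P_5$ denotes the path on $5$ vertices and $W_4$ (the $4$-wheel) denotes the graph consisting of a cycle $C_4$ on four vertices plus one additional vertex adjacent to all four vertices of the $C_4$. A graph is $(H_1,H_2)$-free if it contains no induced subgraph isomorphic to $H_1$ and no induced subgraph isomorphic to $H_2$. $\chi(G)$ denotes the chromatic number of $G$. A graph $G$ is $k$-vertex-critical if $\chi(G)=k$ and $\chi(G-v)<k$ for every vertex $v \in V(G)$. -}

module Defs where

open import Data.Nat using (ℕ; zero; suc; _≤_; _<_)
open import Data.Fin using (Fin; zero; suc; toℕ; punchIn)
open import Data.Bool using (Bool; true; false; _∨_)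
open import Data.Bool.Properties using (∨-comm)
open import Data.Product using (Σ; _×_; _,_; ∃)
open import Data.List using (List)
open import Data.List.Relation.Unary.Any using (Any)
open import Function.Bundles using (_↔_; Inverse)
open import Function.Definitions using (Injective)
open import Relation.Nullary using (¬_)
open import Relation.Binary.PropositionalEquality using (_≡_; _≢_; refl)

record Graph (n : ℕ) : Set where
  field
    adj    : Fin n → Fin n → Bool
    sym    : ∀ i j → adj i j ≡ adj j i
    irrefl : ∀ i → adj i i ≡ false
open Graph public

AnyGraph : Set
AnyGraph = Σ ℕ Graph

Isomorphic : ∀ {n m} → Graph n → Graph m → Set
Isomorphic {n} {m} G H =
  Σ (Fin n ↔ Fin m) λ f → ∀ i j → adj G i j ≡ adj H (Inverse.to f i) (Inverse.to f j)

ContainsInduced : ∀ {n m} → Graph n → Graph m → Set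
ContainsInduced {n} {m} G H =
  Σ (Fin m → Fin n) λ f → Injective _≡_ _≡_ f × (∀ i j → adj H i j ≡ adj G (f i) (f j))

Free : ∀ {n m} → Graph m → Graph n → Set
Free H G = ¬ ContainsInduced G H

p5e : Fin 5 → Fin 5 → Bool
p5e zero (suc zero) = true
p5e (suc zero) (suc (suc zero)) = true
p5e (suc (suc zero)) (suc (suc (suc zero))) = true
p5e (suc (suc (suc zero))) (suc (suc (suc (suc zero)))) = true
p5e _ _ = false

P5 : Graph 5
P5 = record
  { adj = λ i j → p5e i j ∨ p5e j i
  ; sym = λ i j → ∨-comm (p5e i j) (p5e j i)
  ; irrefl = irr }
  where
  irr : ∀ i → p5e i i ∨ p5e i i ≡ false
  irr zero = refl
  irr (suc zero) = refl
  irr (suc (suc zero)) = refl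
  irr (suc (suc (suc zero))) = refl
  irr (suc (suc (suc (suc zero)))) = refl

w4e : Fin 5 → Fin 5 → Bool
w4e zero (suc zero) = true
w4e (suc zero) (suc (suc zero)) = true
w4e (suc (suc zero)) (suc (suc (suc zero))) = true
w4e (suc (suc (suc zero))) zero = true
w4e zero (suc (suc (suc (suc zero)))) = true
w4e (suc zero) (suc (suc (suc (suc zero)))) = true
w4e (suc (suc zero)) (suc (suc (suc (suc zero)))) = true
w4e (suc (suc (suc zero))) (suc (suc (suc (suc zero)))) = true
w4e _ _ = false

W4 : Graph 5
W4 = record
  { adj = λ i j → w4e i j ∨ w4e j i
  ; sym = λ i j → ∨-comm (w4e i j) (w4e j i)
  ; irrefl = irr }
  where
  irr : ∀ i → w4e i i ∨ w4e i i ≡ false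
  irr zero = refl
  irr (suc zero) = refl
  irr (suc (suc zero)) = refl
  irr (suc (suc (suc zero))) = refl
  irr (suc (suc (suc (suc zero)))) = refl

Colorable : ∀ {n} → Graph n → ℕ → Set
Colorable {n} G k =
  Σ (Fin n → Fin k) λ c → ∀ i j → adj G i j ≡ true → c i ≢ c j

ChromaticNumber : ∀ {n} → Graph n → ℕ → Set
ChromaticNumber G k = Colorable G k × (∀ j → Colorable G j → k ≤ j)

deleteVertex : ∀ {n} → Graph (suc n) → Fin (suc n) → Graph n
deleteVertex G v = record
  { adj = λ i j → adj G (punchIn v i) (punchIn v j)
  ; sym = λ i j → sym G (punchIn v i) (punchIn v j)
  ; irrefl = λ i → irrefl G (punchIn v i) }

VertexCritical : ℕ → AnyGraph → Set
VertexCritical k (zero , G) = ChromaticNumber G k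
VertexCritical k (suc n , G) =
  ChromaticNumber G k × (∀ v → ∃ λ j → j < k × ChromaticNumber (deleteVertex G v) j)

P5W4Free : AnyGraph → Set
P5W4Free (_ , G) = Free P5 G × Free W4 G

IsoAny : AnyGraph → AnyGraph → Set
IsoAny (_ , G) (_ , H) = Isomorphic G H

FinitelyManyUpToIso : (AnyGraph → Set) → Set
FinitelyManyUpToIso P =
  Σ (List AnyGraph) λ L → ∀ G → P G → Any (IsoAny G) L

{-# OPTIONS --safe #-}

-- Let G be critical.  By downward induction on the size of a clique C, a connected vertex set Q
-- complete to C has bounded size; C = ∅ and Q = V(G) give the theorem.  If Q is huge, some b ∈ Q has
-- many pairwise nonadjacent neighbours in Q, because a connected P5-free graph has diameter at most 3.
-- These are one-vertex members of a family of pairwise anticomplete copies of one labelled connected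
-- graph, all complete to C ∪ {b}, and such a family can be grown: a large family contains a smaller
-- one whose members Qᵢ can be enlarged by one vertex xᵢ each.  Repeating this contradicts the bound
-- for C ∪ {b}.
--
-- To grow, note that for Q ≠ Q′ in the family some x ∉ Q is adjacent to a vertex of Q but not to the
-- corresponding vertex of Q′, as otherwise a colouring of G − Q would extend to G.  By P5-freeness
-- such an x is complete or anticomplete to all other members but one, so Ramsey's theorem leaves
-- three patterns for the vertices xᵢ: an induced matching with the Qᵢ (then xᵢ can be added to Qᵢ), a
-- co-matching (which contains a P5) or a half graph.  In a half graph with vertices yᵢ, all but few
-- yᵢ are not adjacent to b (W4), and among the vertices separating one member from suitable earlier
-- ones those not adjacent to b form a clique; hence some separating vertex w is adjacent to b, and
-- such a w meets at most two members, which again yields an induced matching.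

module Submission where

open import Defs
open import Data.Nat using (ℕ; _≥_)
open import Data.Product using (_×_)

open import Data.Bool using (Bool; true; false; _∧_; _∨_; not; if_then_else_)
open import Data.Bool.Properties as Bool using (¬-not)
open import Data.Empty using (⊥; ⊥-elim)
open import Data.Fin using (Fin; zero; suc; punchOut; toℕ; fromℕ<)
open import Data.Fin.Properties using (_≟_; all?; any?; ¬∀⟶∃¬; injective⇒≤; punchIn-punchOut; toℕ<n; toℕ-injective; fromℕ<-injective)
open import Data.List using (List; []; _∷_; _++_; [_]; length; map; concatMap; filter; allFin; lookup; cartesianProductWith; upTo; reverse)
open import Data.List.Properties using (length-++; length-map; length-reverse; unfold-reverse)
open import Data.List.Membership.Propositional using (_∈_; find)
import Data.List.Membership.DecPropositional as DecMembership
open import Data.List.Membership.Propositional.Properties using (∈-concatMap⁺; ∈-concatMap⁻; ∈-filter⁺; ∈-filter⁻; ∈-++⁺ˡ; ∈-++⁺ʳ; ∈-++⁻; ∈-allFin; ∈-upTo⁺; ∈-lookup)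
open import Data.List.Relation.Unary.All as All using (All; []; _∷_)
import Data.List.Relation.Unary.All.Properties as All
open import Data.List.Relation.Unary.AllPairs as AllPairs using (AllPairs; []; _∷_)
import Data.List.Relation.Unary.AllPairs.Properties as AllPairs
open import Data.List.Relation.Unary.Any as Any using (Any; here; there; index)
import Data.List.Relation.Unary.Any.Properties as Any
open import Data.List.Relation.Unary.Unique.Propositional.Properties using (allFin⁺; filter⁺)
open import Data.Nat using (zero; suc; _+_; _*_; _≤_; _<_; z≤n; s≤s; _≤?_)
open import Data.Nat.Properties using (≤-refl; ≤-trans; ≤-reflexive; ≤-pred; +-suc; +-comm; +-mono-≤; *-monoˡ-≤; ≰⇒>; ≮⇒≥; <⇒≤; <-irrefl; m≤m+n; 1+n≰n; <-≤-trans)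
open import Data.Product using (Σ; ∃; ∃₂; _,_; proj₁; proj₂)
open import Data.Unit using (⊤; tt)
open import Data.Sum using (_⊎_; inj₁; inj₂; [_,_]′)
open import Function using (_∘_; id; flip)
open import Function.Construct.Identity using (↔-id)
open import Function.Definitions using (Injective)
open import Relation.Binary using () renaming (Decidable to Decidable₂)
open import Relation.Binary.PropositionalEquality using (_≡_; _≢_; refl; trans; cong; cong₂; subst) renaming (sym to ≡-sym)
open import Relation.Nullary using (¬_; Dec; yes; no; does; ¬?; contradiction)
open import Relation.Nullary.Decidable using (toWitness; _×-dec_; _⊎-dec_; _→-dec_; dec-true)
open import Relation.Unary using (Decidable)

-- Families: lists with a relation from each element to all later ones.

private variable
  A B : Set

-- `R` always points from an earlier to a later element, so it may be asymmetric; `m` is only a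
-- lower bound for the length.
record Family {A : Set} (P : A → Set) (R : A → A → Set) (m : ℕ) : Set where
  constructor family
  field
    elems : List A
    size  : m ≤ length elems
    all   : All P elems
    pairs : AllPairs R elems
open Family

infixr 5 _◂_
_◂_ : {P P′ : A → Set} {R : A → A → Set} {x : A} {m : ℕ} →
      P x × (∀ {y} → P′ y → P y × R x y) → Family P′ R m → Family P R (suc m)
(px , h) ◂ family ys le ps rs =
  family (_ ∷ ys) (s≤s le) (px ∷ All.map (proj₁ ∘ h) ps) (All.map (proj₂ ∘ h) ps ∷ rs)

weaken : {P P′ : A → Set} {R R′ : A → A → Set} {m : ℕ} →
         (∀ {x} → P x → P′ x) → (∀ {x y} → R x y → R′ x y) → Family P R m → Family P′ R′ m
weaken f g (family xs le ps rs) = family xs le (All.map f ps) (AllPairs.map g rs)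

mapPred : {P P′ : A → Set} {R : A → A → Set} {m : ℕ} →
          (∀ {x} → P x → P′ x) → Family P R m → Family P′ R m
mapPred f = weaken f id

-- The map may depend on the proof of `P x`, because new vertices are extracted from such proofs.
mapFamily : {P : A → Set} {R : A → A → Set} {P′ : B → Set} {R′ : B → B → Set} {m : ℕ}
            (f : ∀ x → P x → B) → (∀ {x} (p : P x) → P′ (f x p)) →
            (∀ {x y} (p : P x) (q : P y) → R x y → R′ (f x p) (f y q)) →
            Family P R m → Family P′ R′ m
mapFamily {A = A} {B = B} {P} {R} {P′} {R′} f fP fR (family xs le ps rs) =
  family (image ps) (subst (_ ≤_) (≡-sym (len ps)) le) (good ps) (rel ps rs)
  where
  image : ∀ {xs} → All P xs → List B
  image []       = []
  image (p ∷ ps) = f _ p ∷ image ps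
  len : ∀ {xs} (ps : All P xs) → length (image ps) ≡ length xs
  len []       = refl
  len (p ∷ ps) = cong suc (len ps)
  good : ∀ {xs} (ps : All P xs) → All P′ (image ps)
  good []       = []
  good (p ∷ ps) = fP p ∷ good ps
  relHead : ∀ {x xs} (p : P x) (ps : All P xs) → All (R x) xs → All (R′ (f x p)) (image ps)
  relHead p []       []       = []
  relHead p (q ∷ ps) (r ∷ rs) = fR p q r ∷ relHead p ps rs
  rel : ∀ {xs} (ps : All P xs) → AllPairs R xs → AllPairs R′ (image ps)
  rel []       []       = []
  rel (p ∷ ps) (r ∷ rs) = relHead p ps r ∷ rel ps rs

reverseFamily : {P : A → Set} {R : A → A → Set} {m : ℕ} → Family P R m → Family P (flip R) m
reverseFamily {P = P} {R} (family xs le ps rs) =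
  family (reverse xs) (subst (_ ≤_) (≡-sym (length-reverse xs)) le) (rev ps) (revPairs rs)
  where
  rev : ∀ {P : _ → Set} {xs} → All P xs → All P (reverse xs)
  rev []                 = []
  rev {xs = x ∷ xs} (p ∷ ps) rewrite unfold-reverse x xs = All.++⁺ (rev ps) (p ∷ [])
  revPairs : ∀ {xs} → AllPairs R xs → AllPairs (flip R) (reverse xs)
  revPairs []                      = []
  revPairs {x ∷ xs} (r ∷ rs) rewrite unfold-reverse x xs =
    AllPairs.++⁺ (revPairs rs) ([] ∷ []) (All.map (_∷ []) (rev r))

two : {P : A → Set} {R : A → A → Set} → Family P R 2 →
      ∃₂ λ x y → P x × P y × R x y
two (family (x ∷ y ∷ _) _ (p ∷ q ∷ _) ((r ∷ _) ∷ _)) = x , y , p , q , r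
two (family (x ∷ []) (s≤s ()) _ _)

three : {P : A → Set} {R : A → A → Set} → Family P R 3 →
        Σ A λ x → Σ A λ y → Σ A λ z → (P x × P y × P z) × R x y × R x z × R y z
three (family (x ∷ y ∷ z ∷ _) _ (p ∷ q ∷ s ∷ _) ((r ∷ r′ ∷ _) ∷ (r″ ∷ _) ∷ _)) =
  x , y , z , (p , q , s) , r , r′ , r″
three (family (x ∷ []) (s≤s ()) _ _)
three (family (x ∷ y ∷ []) (s≤s (s≤s ())) _ _)

four : {P : A → Set} {R : A → A → Set} → Family P R 4 →
       Σ A λ x → Σ A λ y → Σ A λ z → Σ A λ t → (P x × P y × P z × P t) ×
       (R x y × R x z × R x t) × R y z × R y t × R z t
four (family (x ∷ y ∷ z ∷ t ∷ _) _ (p ∷ q ∷ s ∷ u ∷ _)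
       ((r₁ ∷ r₂ ∷ r₃ ∷ _) ∷ (r₄ ∷ r₅ ∷ _) ∷ (r₆ ∷ _) ∷ _)) =
  x , y , z , t , (p , q , s , u) , (r₁ , r₂ , r₃) , r₄ , r₅ , r₆
four (family (x ∷ []) (s≤s ()) _ _)
four (family (x ∷ y ∷ []) (s≤s (s≤s ())) _ _)
four (family (x ∷ y ∷ z ∷ []) (s≤s (s≤s (s≤s ()))) _ _)

-- Pigeonhole principle and Ramsey's theorem.

split : {P Q : A → Set} {R : A → A → Set} → Decidable Q → ∀ a b → Family P R (a + b) →
        Family (λ x → P x × Q x) R a ⊎ Family (λ x → P x × ¬ Q x) R b
split {A = A} {Q = Q} {R} Q? a b (family xs le ps rs) = go a b xs le ps rs
  where
  -- `P` varies in the recursion: the relation to a passed element is stored in the predicate before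
  -- the tail is thinned out.
  go : {P : A → Set} → ∀ a b xs → a + b ≤ length xs → All P xs → AllPairs R xs →
       Family (λ x → P x × Q x) R a ⊎ Family (λ x → P x × ¬ Q x) R b
  go zero    b       xs       le ps rs = inj₁ (family [] z≤n [] [])
  go (suc a) zero    xs       le ps rs = inj₂ (family [] z≤n [] [])
  go (suc a) (suc b) (x ∷ xs) (s≤s le) (p ∷ ps) (r ∷ rs) with Q? x
  ... | yes q with go a (suc b) xs le (All.zip (ps , r)) rs
  ...   | inj₁ F = inj₁ (((p , q) , λ { ((p′ , r′) , q′) → (p′ , q′) , r′ }) ◂ F)
  ...   | inj₂ F = inj₂ (mapPred (λ { ((p′ , _) , q′) → p′ , q′ }) F)
  go (suc a) (suc b) (x ∷ xs) (s≤s le) (p ∷ ps) (r ∷ rs) | no ¬q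
    with go (suc a) b xs (subst (_≤ length xs) (+-suc a b) le) (All.zip (ps , r)) rs
  ...   | inj₁ F = inj₁ (mapPred (λ { ((p′ , _) , q′) → p′ , q′ }) F)
  ...   | inj₂ F = inj₂ (((p , ¬q) , λ { ((p′ , r′) , q′) → (p′ , q′) , r′ }) ◂ F)

-- The Erdős-Szekeres recursion for Ramsey numbers.
ramseyBound : ℕ → ℕ → ℕ
ramseyBound zero    b       = 0
ramseyBound (suc a) zero    = 0
ramseyBound (suc a) (suc b) = suc (ramseyBound a (suc b) + ramseyBound (suc a) b)

-- `C` is tested with the earlier element first and may be asymmetric; this is how half graphs arise
-- below.
ramsey : {P : A → Set} {R C : A → A → Set} → Decidable₂ C → ∀ a b → Family P R (ramseyBound a b) →
         Family P (λ x y → R x y × C x y) a ⊎ Family P (λ x y → R x y × ¬ C x y) b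
ramsey C? zero    b       F = inj₁ (family [] z≤n [] [])
ramsey C? (suc a) zero    F = inj₂ (family [] z≤n [] [])
ramsey C? (suc a) (suc b) (family (x ∷ xs) (s≤s le) (p ∷ ps) (r ∷ rs))
  with split (C? x) (ramseyBound a (suc b)) (ramseyBound (suc a) b)
         (family xs le (All.zip (ps , r)) rs)
... | inj₁ F with ramsey C? a (suc b) F
...   | inj₁ F′ = inj₁ ((p , λ { ((p′ , r′) , c) → p′ , r′ , c }) ◂ F′)
...   | inj₂ F′ = inj₂ (mapPred (proj₁ ∘ proj₁) F′)
ramsey C? (suc a) (suc b) (family (x ∷ xs) (s≤s le) (p ∷ ps) (r ∷ rs)) | inj₂ F
  with ramsey C? (suc a) b F
...   | inj₁ F′ = inj₁ (mapPred (proj₁ ∘ proj₁) F′)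
...   | inj₂ F′ = inj₂ ((p , λ { ((p′ , r′) , c) → p′ , r′ , c }) ◂ F′)

forcePairs : {P : A → Set} {R C : A → A → Set} → Decidable₂ C → ∀ a b →
             ¬ Family P (λ x y → R x y × ¬ C x y) b →
             Family P R (ramseyBound a b) → Family P (λ x y → R x y × C x y) a
forcePairs C? a b no-b F = [ id , ⊥-elim ∘ no-b ]′ (ramsey C? a b F)

force : {P Q : A → Set} {R : A → A → Set} → Decidable Q → ∀ a b →
        ¬ Family (λ x → P x × ¬ Q x) R b →
        Family P R (a + b) → Family (λ x → P x × Q x) R a
force Q? a b no-b F = [ id , ⊥-elim ∘ no-b ]′ (split Q? a b F)

-- Reserves an initial segment as a reference set for the later elements.
chop : {P : A → Set} {R : A → A → Set} → ∀ a b → Family P R (a + b) →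
       Σ (Family P R a) λ F → Family (λ y → P y × All (λ x → R x y) (elems F)) R b
chop zero    b F = family [] z≤n [] [] , mapPred (_, []) F
chop (suc a) b (family (x ∷ xs) (s≤s le) (p ∷ ps) (r ∷ rs))
  with chop a b (family xs le (All.zip (ps , r)) rs)
... | F₁ , F₂ =
  (p , id) ◂ F₁ , mapPred (λ { ((p′ , r′) , rs′) → p′ , r′ ∷ rs′ }) F₂

thin : {P : A → Set} {R : A → A → Set} → ∀ m → Family P R (m + m) →
       Family {A × A} (λ (x , y) → P x × P y × R x y)
                      (λ (x , y) (x′ , y′) → R x x′ × R x y′ × R y x′ × R y y′) m
thin {A = A} {R = R} m (family xs le ps rs) = go m xs le ps rs
  where
  go : {P : A → Set} → ∀ m xs → m + m ≤ length xs → All P xs → AllPairs R xs →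
       Family {A × A} (λ (x , y) → P x × P y × R x y)
                      (λ (x , y) (x′ , y′) → R x x′ × R x y′ × R y x′ × R y y′) m
  go zero xs le ps rs = family [] z≤n [] []
  go (suc m) [] () ps rs
  go (suc m) (x ∷ []) (s≤s le) ps rs = contradiction (subst (_≤ 0) (+-suc m m) le) λ ()
  go {P} (suc m) (x ∷ y ∷ zs) (s≤s le) (px ∷ py ∷ ps) ((rxy ∷ rx) ∷ ry ∷ rs) =
    ((px , py , rxy) , λ { ((p , r , s) , (p′ , r′ , s′) , t) → (p , p′ , t) , r , r′ , s , s′ })
    ◂ go {λ z → P z × R x z × R y z} m zs (≤-pred (subst (_≤ suc (length zs)) (+-suc m m) le))
        (All.zip (ps , All.zip (rx , ry))) rs

-- This is 2^q · m.
power : ℕ → ℕ → ℕ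
power zero    m = m
power (suc q) m = power q m + power q m

-- Each of the q coordinates costs a factor of two: one of its two values occurs on at least half of
-- the family.
uniformize : {P : A → Set} {R : A → A → Set} → ∀ {q} (f : A → Fin q → Bool) m →
             Family P R (power q m) →
             Σ (Fin q → Bool) λ v → Family (λ x → P x × ∀ s → f x s ≡ v s) R m
uniformize {q = zero}  f m F = (λ ()) , mapPred (_, λ ()) F
uniformize {q = suc q} f m F
  with split (λ x → f x zero Bool.≟ true) (power q m) (power q m) F
... | inj₁ F′ with uniformize (λ x → f x ∘ suc) m F′
...   | v , F″ = (λ { zero → true ; (suc s) → v s }) ,
                 mapPred (λ { ((p , e) , es) → p , λ { zero → e ; (suc s) → es s } }) F″
uniformize {q = suc q} f m F | inj₂ F′ with uniformize (λ x → f x ∘ suc) m F′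
...   | v , F″ = (λ { zero → false ; (suc s) → v s }) ,
                 mapPred (λ { ((p , e) , es) → p , λ { zero → ¬-not e ; (suc s) → es s } }) F″

-- Adjacency, forbidden induced subgraphs, twins.

module Adjacency {n : ℕ} (G : Graph n) where

  infix 4 _∼_ _≁_
  _∼_ _≁_ : Fin n → Fin n → Set
  u ∼ v = adj G u v ≡ true
  u ≁ v = adj G u v ≡ false

  ~sym : ∀ {u v b} → adj G u v ≡ b → adj G v u ≡ b
  ~sym {u} {v} e = trans (sym G v u) e

  separated : ∀ {x u v} → x ∼ u → x ≁ v → u ≢ v
  separated e f refl with trans (≡-sym e) f
  ... | ()

  -- Distinctness follows from the adjacencies: equal vertices have equal rows, and the rows of `P5`
  -- are pairwise distinct.
  noP5 : Free P5 G → ∀ {a b c d e} → a ∼ b → b ∼ c → c ∼ d → d ∼ e →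
         a ≁ c → a ≁ d → a ≁ e → b ≁ d → b ≁ e → c ≁ e → ⊥
  noP5 free {a} {b} {c} {d} {e} ab bc cd de ac ad ae bd be ce =
    free (f , (λ {i} {j} eq → rows-distinct i j λ l →
                trans (hom i l) (trans (cong (λ v → adj G v (f l)) eq) (≡-sym (hom j l)))) , hom)
    where
    f : Fin 5 → Fin n
    f = lookup (a ∷ b ∷ c ∷ d ∷ e ∷ [])
    rows-distinct : ∀ i j → (∀ l → adj P5 i l ≡ adj P5 j l) → i ≡ j
    rows-distinct = toWitness {a? = all? λ i → all? λ j →
      (all? λ l → adj P5 i l Bool.≟ adj P5 j l) →-dec (i ≟ j)} _
    hom : ∀ i j → adj P5 i j ≡ adj G (f i) (f j)
    hom zero zero = ≡-sym (irrefl G a)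
    hom zero (suc zero) = ≡-sym ab
    hom zero (suc (suc zero)) = ≡-sym ac
    hom zero (suc (suc (suc zero))) = ≡-sym ad
    hom zero (suc (suc (suc (suc zero)))) = ≡-sym ae
    hom (suc zero) zero = ≡-sym (~sym ab)
    hom (suc zero) (suc zero) = ≡-sym (irrefl G b)
    hom (suc zero) (suc (suc zero)) = ≡-sym bc
    hom (suc zero) (suc (suc (suc zero))) = ≡-sym bd
    hom (suc zero) (suc (suc (suc (suc zero)))) = ≡-sym be
    hom (suc (suc zero)) zero = ≡-sym (~sym ac)
    hom (suc (suc zero)) (suc zero) = ≡-sym (~sym bc)
    hom (suc (suc zero)) (suc (suc zero)) = ≡-sym (irrefl G c)
    hom (suc (suc zero)) (suc (suc (suc zero))) = ≡-sym cd
    hom (suc (suc zero)) (suc (suc (suc (suc zero)))) = ≡-sym ce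
    hom (suc (suc (suc zero))) zero = ≡-sym (~sym ad)
    hom (suc (suc (suc zero))) (suc zero) = ≡-sym (~sym bd)
    hom (suc (suc (suc zero))) (suc (suc zero)) = ≡-sym (~sym cd)
    hom (suc (suc (suc zero))) (suc (suc (suc zero))) = ≡-sym (irrefl G d)
    hom (suc (suc (suc zero))) (suc (suc (suc (suc zero)))) = ≡-sym de
    hom (suc (suc (suc (suc zero)))) zero = ≡-sym (~sym ae)
    hom (suc (suc (suc (suc zero)))) (suc zero) = ≡-sym (~sym be)
    hom (suc (suc (suc (suc zero)))) (suc (suc zero)) = ≡-sym (~sym ce)
    hom (suc (suc (suc (suc zero)))) (suc (suc (suc zero))) = ≡-sym (~sym de)
    hom (suc (suc (suc (suc zero)))) (suc (suc (suc (suc zero)))) = ≡-sym (irrefl G e)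

  -- Only opposite rim vertices have equal rows in `W4`; these are kept apart by `a ≢ c` and
  -- `b ≢ d`, all others by their rows.
  noW4 : Free W4 G → ∀ {a b c d h} → a ∼ b → b ∼ c → c ∼ d → d ∼ a → a ≁ c → b ≁ d → a ≢ c → b ≢ d →
         h ∼ a → h ∼ b → h ∼ c → h ∼ d → ⊥
  noW4 free {a} {b} {c} {d} {h} ab bc cd da ac bd a≢c b≢d ha hb hc hd =
    free (f , (λ {i} {j} → inj i j) , hom)
    where
    f : Fin 5 → Fin n
    f = lookup (a ∷ b ∷ c ∷ d ∷ h ∷ [])
    hom : ∀ i j → adj W4 i j ≡ adj G (f i) (f j)
    hom zero zero = ≡-sym (irrefl G a)
    hom zero (suc zero) = ≡-sym ab
    hom zero (suc (suc zero)) = ≡-sym ac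
    hom zero (suc (suc (suc zero))) = ≡-sym (~sym da)
    hom zero (suc (suc (suc (suc zero)))) = ≡-sym (~sym ha)
    hom (suc zero) zero = ≡-sym (~sym ab)
    hom (suc zero) (suc zero) = ≡-sym (irrefl G b)
    hom (suc zero) (suc (suc zero)) = ≡-sym bc
    hom (suc zero) (suc (suc (suc zero))) = ≡-sym bd
    hom (suc zero) (suc (suc (suc (suc zero)))) = ≡-sym (~sym hb)
    hom (suc (suc zero)) zero = ≡-sym (~sym ac)
    hom (suc (suc zero)) (suc zero) = ≡-sym (~sym bc)
    hom (suc (suc zero)) (suc (suc zero)) = ≡-sym (irrefl G c)
    hom (suc (suc zero)) (suc (suc (suc zero))) = ≡-sym cd
    hom (suc (suc zero)) (suc (suc (suc (suc zero)))) = ≡-sym (~sym hc)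
    hom (suc (suc (suc zero))) zero = ≡-sym da
    hom (suc (suc (suc zero))) (suc zero) = ≡-sym (~sym bd)
    hom (suc (suc (suc zero))) (suc (suc zero)) = ≡-sym (~sym cd)
    hom (suc (suc (suc zero))) (suc (suc (suc zero))) = ≡-sym (irrefl G d)
    hom (suc (suc (suc zero))) (suc (suc (suc (suc zero)))) = ≡-sym (~sym hd)
    hom (suc (suc (suc (suc zero)))) zero = ≡-sym ha
    hom (suc (suc (suc (suc zero)))) (suc zero) = ≡-sym hb
    hom (suc (suc (suc (suc zero)))) (suc (suc zero)) = ≡-sym hc
    hom (suc (suc (suc (suc zero)))) (suc (suc (suc zero))) = ≡-sym hd
    hom (suc (suc (suc (suc zero)))) (suc (suc (suc (suc zero)))) = ≡-sym (irrefl G h)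
    rows : ∀ i j → (∀ l → adj W4 i l ≡ adj W4 j l) → i ≢ j →
           (i ≡ zero × j ≡ suc (suc zero)) ⊎ (j ≡ zero × i ≡ suc (suc zero)) ⊎
           (i ≡ suc zero × j ≡ suc (suc (suc zero))) ⊎ (j ≡ suc zero × i ≡ suc (suc (suc zero)))
    rows = toWitness {a? = all? λ i → all? λ j →
      (all? λ l → adj W4 i l Bool.≟ adj W4 j l) →-dec (¬? (i ≟ j) →-dec
        ((i ≟ zero ×-dec j ≟ suc (suc zero)) ⊎-dec (j ≟ zero ×-dec i ≟ suc (suc zero)) ⊎-dec
         (i ≟ suc zero ×-dec j ≟ suc (suc (suc zero))) ⊎-dec
         (j ≟ suc zero ×-dec i ≟ suc (suc (suc zero)))))} _
    inj : ∀ i j → f i ≡ f j → i ≡ j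
    inj i j eq with i ≟ j
    ... | yes i≡j = i≡j
    ... | no  i≢j with rows i j (λ l →
            trans (hom i l) (trans (cong (λ v → adj G v (f l)) eq) (≡-sym (hom j l)))) i≢j
    ...   | inj₁ (refl , refl)               = contradiction eq a≢c
    ...   | inj₂ (inj₁ (refl , refl))        = contradiction (≡-sym eq) a≢c
    ...   | inj₂ (inj₂ (inj₁ (refl , refl))) = contradiction eq b≢d
    ...   | inj₂ (inj₂ (inj₂ (refl , refl))) = contradiction (≡-sym eq) b≢d

  Full Anti : ∀ {p} → Fin n → (Fin p → Fin n) → Set
  Full x Q = ∀ s → x ∼ Q s
  Anti x Q = ∀ s → x ≁ Q s

  full? : ∀ {p} x (Q : Fin p → Fin n) → Dec (Full x Q)
  full? x Q = all? λ s → adj G x (Q s) Bool.≟ true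

  anti? : ∀ {p} x (Q : Fin p → Fin n) → Dec (Anti x Q)
  anti? x Q = all? λ s → adj G x (Q s) Bool.≟ false

  ¬anti⇒ : ∀ {p x} {Q : Fin p → Fin n} → ¬ Anti x Q → ∃ λ s → x ∼ Q s
  ¬anti⇒ {x = x} {Q} ¬anti with ¬∀⟶∃¬ _ _ (λ s → adj G x (Q s) Bool.≟ false) ¬anti
  ... | s , ne = s , ¬-not ne

  -- A vertex set is given by an enumeration Q, injective where its size matters.
  Connected : ∀ {p} → (Fin p → Fin n) → Set
  Connected {p} Q = (P : Fin p → Bool) → (∀ s t → Q s ∼ Q t → P s ≡ true → P t ≡ true) →
                    ∀ s → P s ≡ true → ∀ t → P t ≡ true

  infixr 5 _◃_
  _◃_ : ∀ {p} → Fin n → (Fin p → Fin n) → Fin (suc p) → Fin n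
  (x ◃ Q) zero    = x
  (x ◃ Q) (suc s) = Q s

  connected-◃ : ∀ {p x} {Q : Fin p → Fin n} → Connected Q → ∀ s → x ∼ Q s → Connected (x ◃ Q)
  connected-◃ {Q = Q} con s₀ e P closed = go
    where
    all-Q : ∀ s → P (suc s) ≡ true → ∀ t → P t ≡ true
    all-Q s Ps zero    = closed (suc s₀) zero (~sym e) (all-Q s Ps (suc s₀))
    all-Q s Ps (suc t) = con (P ∘ suc) (λ s t → closed (suc s) (suc t)) s Ps t
    go : ∀ s → P s ≡ true → ∀ t → P t ≡ true
    go zero    Px = all-Q s₀ (closed zero (suc s₀) e Px)
    go (suc s) Ps = all-Q s Ps

  Disjoint : ∀ {p} → (Q Q′ : Fin p → Fin n) → Set
  Disjoint Q Q′ = ∀ s t → Q s ≁ Q′ t × Q s ≢ Q′ t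

  Twin : ∀ {p} → (Q Q′ : Fin p → Fin n) → Set
  Twin Q Q′ = Disjoint Q Q′ × (∀ s t → adj G (Q s) (Q t) ≡ adj G (Q′ s) (Q′ t))

  twin-sym : ∀ {p} {Q Q′ : Fin p → Fin n} → Twin Q Q′ → Twin Q′ Q
  twin-sym (dis , copy) =
    (λ s t → ~sym (proj₁ (dis t s)) , λ e → proj₂ (dis t s) (≡-sym e)) , λ s t → ≡-sym (copy s t)

  -- The colour of v itself is junk.
  record ColouringOff (k : ℕ) (v : Fin n) : Set where
    field
      colour : Fin n → ℕ
      bound  : ∀ {u} → u ≢ v → colour u < k
      proper : ∀ {u w} → u ≢ v → w ≢ v → u ∼ w → colour u ≢ colour w

  -- Here k + 1 is the chromatic number.
  record Critical (k : ℕ) : Set where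
    field
      P5-free       : Free P5 G
      W4-free       : Free W4 G
      no-clique     : ∀ xs → suc (suc k) ≤ length xs → ¬ AllPairs _∼_ xs
      colouring-off : ∀ v → ColouringOff k v
      uncolourable  : (c : Fin n → ℕ) → (∀ u → c u < k) → ¬ (∀ {u w} → u ∼ w → c u ≢ c w)

-- Numerical bounds.

triBound : ℕ → ℕ
triBound zero    = 0
-- Two members provide a separator; then `triBound s` members are kept to which it is complete, or
-- `triBound s + 2` to which it is not, of which at most one is mixed.
triBound (suc s) = suc (suc (triBound s + (triBound s + 2)))

-- Each of the d clique vertices excludes at most one item.
attachBound : ℕ → ℕ → ℕ
attachBound zero    m = m
attachBound (suc d) m = attachBound d m + 2

-- Bounds a ball of radius three when all degrees are at most D.
ballBound : ℕ → ℕ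
ballBound D = 1 + (D + (D * D + D * D * D))

module Bounds (k : ℕ) where

  -- The chromatic number is k + 1, so no clique has K vertices.
  K : ℕ
  K = suc (suc k)

  outBound : ℕ → ℕ → ℕ
  outBound m c = ramseyBound (ramseyBound m (ramseyBound c 3)) K

  inBound : ℕ → ℕ
  inBound c = ramseyBound (ramseyBound 3 (ramseyBound c 3)) K

  hitBound : ℕ → ℕ
  hitBound m = ramseyBound (ramseyBound (ramseyBound m K) 4) 4

  -- `own-chain` halves the chain, `outer-chain` drops at most two items, and `suc K` items serve as
  -- references for the last `hitBound m`.
  chainBound : ℕ → ℕ
  chainBound m = ((suc K + hitBound m) + 3) + ((suc K + hitBound m) + 3)

  matchBound : ℕ → ℕ
  matchBound m = triBound (outBound m (chainBound m) + inBound (chainBound m))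

  growBound : ℕ → ℕ → ℕ → ℕ
  growBound d p m = matchBound (attachBound d (power (suc p) m))

  -- Enough members on p + 1 vertices to grow them j times and keep one.
  familyBound : ℕ → ℕ → ℕ → ℕ
  familyBound d zero    p = 1
  familyBound d (suc j) p = growBound d p (familyBound d j (suc p))

  -- Here d is the size of the clique and f the number of vertices it lacks to size `K`.
  sizeBound : ℕ → ℕ → ℕ
  sizeBound zero    d = 0
  sizeBound (suc f) d = ballBound (ramseyBound (familyBound (suc d) (sizeBound f (suc d)) 0) K)

-- Separators of twins and mixed vertices.

module Growth {n k : ℕ} {G : Graph n} (critical : Adjacency.Critical G k) where

  open Adjacency G
  open Critical critical
  open Bounds k

  private
    V = Fin n

  p5 : ∀ {a b c d e} → a ∼ b → b ∼ c → c ∼ d → d ∼ e →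
       a ≁ c → a ≁ d → a ≁ e → b ≁ d → b ≁ e → c ≁ e → ⊥
  p5 = noP5 P5-free

  -- Otherwise giving Q t the colour of Q′ t extends a colouring of G − Q to G.
  distinguish : ∀ {p} {Q Q′ : Fin (suc p) → V} → Injective _≡_ _≡_ Q → Twin Q Q′ →
                ∃ λ x → ∃ λ t → (∀ s → Q s ≢ x) × x ∼ Q t × x ≁ Q′ t
  distinguish {Q = Q} {Q′} inj (dis , copy)
    with any? (λ x → any? λ t → all? (λ s → ¬? (Q s ≟ x)) ×-dec
                (adj G x (Q t) Bool.≟ true) ×-dec (adj G x (Q′ t) Bool.≟ false))
  ... | yes r = r
  ... | no ¬sep = ⊥-elim (uncolourable c′ bound proper)
    where
    -- Omitting one vertex of Q is enough, since the colours on all of Q are overwritten.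
    open ColouringOff (colouring-off (Q zero))
      renaming (colour to c; bound to c-bound; proper to c-proper)
    off : ∀ t → Q′ t ≢ Q zero
    off t e = proj₂ (dis zero t) (≡-sym e)
    member? : ∀ u → Dec (∃ λ s → Q s ≡ u)
    member? u = any? λ s → Q s ≟ u
    c′ : V → ℕ
    c′ u with member? u
    ... | yes (s , _) = c (Q′ s)
    ... | no _        = c u
    bound : ∀ u → c′ u < k
    bound u with member? u
    ... | yes (s , _) = c-bound (off s)
    ... | no u∉       = c-bound λ e → u∉ (zero , ≡-sym e)
    inherit : ∀ {s w} → ¬ (∃ λ s → Q s ≡ w) → Q s ∼ w → Q′ s ∼ w
    inherit {s} {w} w∉ e with adj G w (Q′ s) in eq
    ... | true  = ~sym eq
    ... | false = ⊥-elim (¬sep (w , s , (λ t e′ → w∉ (t , e′)) , ~sym e , eq))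
    proper : ∀ {u w} → u ∼ w → c′ u ≢ c′ w
    proper {u} {w} e with member? u | member? w
    ... | yes (s , refl) | yes (t , refl) = c-proper (off s) (off t) (trans (≡-sym (copy s t)) e)
    ... | yes (s , refl) | no w∉ =
      c-proper (off s) (λ e′ → w∉ (zero , ≡-sym e′)) (inherit w∉ e)
    ... | no u∉ | yes (t , refl) =
      c-proper (λ e′ → u∉ (zero , ≡-sym e′)) (off t) (~sym (inherit u∉ (~sym e)))
    ... | no u∉ | no w∉ =
      c-proper (λ e′ → u∉ (zero , ≡-sym e′)) (λ e′ → w∉ (zero , ≡-sym e′)) e

  -- Otherwise the neighbours of x in Q are closed under adjacency in Q, hence are all of Q.
  crossing : ∀ {p x} {Q : Fin p → V} → Connected Q → ¬ Full x Q → ¬ Anti x Q →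
             ∃₂ λ s t → Q s ∼ Q t × x ∼ Q s × x ≁ Q t
  crossing {x = x} {Q} con ¬full ¬anti
    with any? (λ s → any? λ t → (adj G (Q s) (Q t) Bool.≟ true) ×-dec
                 (adj G x (Q s) Bool.≟ true) ×-dec (adj G x (Q t) Bool.≟ false))
  ... | yes r = r
  ... | no ¬cross = ⊥-elim (¬full (con (adj G x ∘ Q) closed _ (proj₂ (¬anti⇒ ¬anti))))
    where
    closed : ∀ s t → Q s ∼ Q t → x ∼ Q s → x ∼ Q t
    closed s t e f with adj G x (Q t) in eq
    ... | true  = refl
    ... | false = ⊥-elim (¬cross (s , t , e , f , eq))

  -- Edges Q s – Q t and Q′ s′ – Q′ t′ that x meets in one end each give the P5 Q t – Q s – x – Q′ s′ – Q′ t′.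
  mixed-unique : ∀ {p x} {Q Q′ : Fin p → V} → Connected Q → Connected Q′ → Disjoint Q Q′ →
                 ¬ Full x Q → ¬ Anti x Q → ¬ Full x Q′ → ¬ Anti x Q′ → ⊥
  mixed-unique con con′ dis ¬f ¬a ¬f′ ¬a′
    with crossing con ¬f ¬a | crossing con′ ¬f′ ¬a′
  ... | s , t , e , xs , xt | s′ , t′ , e′ , xs′ , xt′ =
    p5 (~sym e) (~sym xs) xs′ e′ (~sym xt) (proj₁ (dis t s′)) (proj₁ (dis t t′))
       (proj₁ (dis s s′)) (proj₁ (dis s t′)) xt′

  no-clique-family : {P : A → Set} {R : A → A → Set} (f : A → V) →
                     (∀ {x y} → R x y → f x ∼ f y) → ¬ Family P R K
  no-clique-family f adjacent (family xs le _ rs) =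
    no-clique (map f xs) (subst (K ≤_) (≡-sym (length-map f xs)) le)
      (AllPairs.map⁺ (AllPairs.map adjacent rs))

  -- Members with candidate vertices, and their triangular selection.

  record Good {p : ℕ} (C : List V) (Q : Fin p → V) : Set where
    constructor good
    field
      injective : Injective _≡_ _≡_ Q
      connected : Connected Q
      complete  : All (λ c → Full c Q) C
  open Good

  -- A member and a candidate for enlarging it or related members; `suc p` makes the member
  -- nonempty.
  Item : ℕ → Set
  Item p = (Fin (suc p) → V) × V

  module _ {p : ℕ} (C : List V) where

    GoodItem Private Missing : Item p → Set
    GoodItem (Q , x) = Good C Q
    Private  (Q , x) = Good C Q × (∀ s → Q s ≢ x) × ∃ λ s → x ∼ Q s
    Missing  (Q , x) = Good C Q × ∃ λ s → x ≁ Q s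

  -- The first two leave open how x′ meets the earlier member; `Matching` is an induced matching and
  -- `Chain` a half graph. None says how x meets its own Q.
  AntiLater FullLater Matching Chain : ∀ {p} → Item p → Item p → Set
  AntiLater (Q , x) (Q′ , x′) = Twin Q Q′ × Anti x Q′
  FullLater (Q , x) (Q′ , x′) = Twin Q Q′ × Full x Q′
  Matching  (Q , x) (Q′ , x′) = Twin Q Q′ × Anti x Q′ × Anti x′ Q × x ≁ x′
  Chain     (Q , x) (Q′ , x′) = Twin Q Q′ × Anti x Q′ × Full x′ Q × x ≁ x′

  Triangular : ∀ {p} → List V → ((Fin (suc p) → V) → Set) → ℕ → ℕ → Set
  Triangular {p} C H a b =
    Family {Item p} (λ i → Private C i × H (proj₁ i)) AntiLater a ⊎
    Family {Item p} (λ i → Missing C i × H (proj₁ i)) FullLater b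

  no-two-mixed : ∀ {p C x} {P : (Fin (suc p) → V) → Set} → (∀ {Q} → P Q → Good C Q) →
                 ¬ Family (λ Q → (P Q × ¬ Full x Q) × ¬ Anti x Q) Twin 2
  no-two-mixed isGood F with two F
  ... | _ , _ , ((p₁ , ¬f₁) , ¬a₁) , ((p₂ , ¬f₂) , ¬a₂) , tw =
    mixed-unique (connected (isGood p₁)) (connected (isGood p₂)) (proj₁ tw) ¬f₁ ¬a₁ ¬f₂ ¬a₂

  -- Each separator x of the first two members is complete or anticomplete to at least about half of
  -- the remaining ones; keep those.  H records the relation of the survivors to the items already chosen.
  triangular : ∀ {p C} (H : (Fin (suc p) → V) → Set) a b →
               Family (λ Q → Good C Q × H Q) Twin (triBound (a + b)) → Triangular C H a b
  triangular H zero    b    F = inj₁ (family [] z≤n [] [])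
  triangular H (suc a) zero F = inj₂ (family [] z≤n [] [])
  triangular {p} {C} H (suc a) (suc b)
    (family (Q ∷ Q′ ∷ Qs) (s≤s (s≤s le)) ((g , h) ∷ (g′ , h′) ∷ ps) ((tw ∷ r) ∷ r′ ∷ rs)) =
    [ full-case , anti-case ]′ (split (full? x) T (T + 2) rest)
    where
    T : ℕ
    T = triBound (a + suc b)
    separator : ∃ λ x → ∃ λ t → (∀ s → Q s ≢ x) × x ∼ Q t × x ≁ Q′ t
    separator = distinguish (injective g) tw
    x : V
    x = proj₁ separator
    Rest : (Fin (suc p) → V) → Set
    Rest Q″ = (Good C Q″ × H Q″) × Twin Q Q″ × Twin Q′ Q″
    rest : Family Rest Twin (T + (T + 2))
    rest = family Qs le (All.zip (ps , All.zip (r , r′))) rs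
    H₁ H₂ : (Fin (suc p) → V) → Set
    H₁ Q″ = H Q″ × Twin Q′ Q″ × Full x Q″
    H₂ Q″ = H Q″ × Twin Q Q″ × Anti x Q″

    -- If x is complete to the survivors it is paired with Q′, where it has a non-neighbour; if
    -- anticomplete, with Q, where it has a neighbour.
    cons-missing : Triangular C H₁ (suc a) b → Triangular C H (suc a) (suc b)
    cons-missing (inj₁ F) = inj₁ (mapPred (λ (o , h₁ , _) → o , h₁) F)
    cons-missing (inj₂ F) =
      inj₂ ((((g′ , proj₁ (proj₂ separator) , proj₂ (proj₂ (proj₂ (proj₂ separator)))) , h′) ,
             λ (o , h₁ , tw₁ , full) → (o , h₁) , tw₁ , full) ◂ F)

    cons-private : Triangular C H₂ a (suc b) → Triangular C H (suc a) (suc b)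
    cons-private (inj₂ F) = inj₂ (mapPred (λ (o , h₁ , _) → o , h₁) F)
    cons-private (inj₁ F) =
      inj₁ ((((g , proj₁ (proj₂ (proj₂ separator)) , proj₁ (proj₂ separator) ,
               proj₁ (proj₂ (proj₂ (proj₂ separator)))) , h) ,
             λ (o , h₁ , tw₁ , anti) → (o , h₁) , tw₁ , anti) ◂ F)

    full-case : Family (λ Q″ → Rest Q″ × Full x Q″) Twin T → Triangular C H (suc a) (suc b)
    full-case F = cons-missing (triangular H₁ (suc a) b
      (subst (λ s → Family (λ Q″ → Good C Q″ × H₁ Q″) Twin (triBound s)) (+-suc a b)
        (mapPred (λ (((g₁ , h₁) , _ , tw₁) , full) → g₁ , h₁ , tw₁ , full) F)))

    anti-case : Family (λ Q″ → Rest Q″ × ¬ Full x Q″) Twin (T + 2) → Triangular C H (suc a) (suc b)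
    anti-case F = cons-private (triangular H₂ a (suc b)
      (mapPred (λ ((((g₁ , h₁) , tw₁ , _) , _) , anti) → g₁ , h₁ , tw₁ , anti)
        (force (anti? x) T 2 (no-two-mixed (proj₁ ∘ proj₁)) F)))

  -- Ramsey reduction to induced matchings and half graphs.

  stable : {P : A → Set} {R : A → A → Set} (f : A → V) → ∀ m → Family P R (ramseyBound m K) →
           Family P (λ i j → R i j × f i ≁ f j) m
  stable f m = forcePairs (λ i j → adj G (f i) (f j) Bool.≟ false) m K
                 (no-clique-family f λ { (_ , ¬e) → ¬-not ¬e })

  -- The third candidate would be mixed on the first two members.
  no-three-mixed : ∀ {p C} {P : Item p → Set} {R : Item p → Item p → Set} →
                   (∀ {i} → P i → GoodItem C i) →
                   (∀ {i j} → R i j → Twin (proj₁ i) (proj₁ j) ×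
                     ¬ Full (proj₂ j) (proj₁ i) × ¬ Anti (proj₂ j) (proj₁ i)) →
                   ¬ Family P R 3
  no-three-mixed fP fR F with three F
  ... | _ , _ , _ , (p₁ , p₂ , _) , r₁₂ , r₁₃ , r₂₃ with fR r₁₂ | fR r₁₃ | fR r₂₃
  ...   | tw , _ | _ , ¬f₁ , ¬a₁ | _ , ¬f₂ , ¬a₂ =
    mixed-unique (connected (fP p₁)) (connected (fP p₂)) (proj₁ tw) ¬f₁ ¬a₁ ¬f₂ ¬a₂

  -- With the candidates pairwise nonadjacent, Ramsey's theorem settles how later candidates meet
  -- earlier members: anticomplete gives a matching, and what is not mixed otherwise is a half
  -- graph.
  matching-or-chain : ∀ {p C} m c → Family {Item p} (Private C) AntiLater (outBound m c) →
                      Family (Private C) Matching m ⊎ Family (GoodItem C) Chain c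
  matching-or-chain m c F
    with ramsey (λ (Q , _) (_ , x′) → anti? x′ Q) m (ramseyBound c 3)
           (stable proj₂ (ramseyBound m (ramseyBound c 3)) F)
  ... | inj₁ F₁ = inj₁ (weaken id (λ { (((tw , a) , n) , a′) → tw , a , a′ , n }) F₁)
  ... | inj₂ F₁ =
    inj₂ (weaken proj₁ (λ { ((((tw , a) , n) , _) , f) → tw , a , f , n })
      (forcePairs (λ (Q , _) (_ , x′) → full? x′ Q) c 3
        (no-three-mixed proj₁ λ { ((((tw , _) , _) , ¬a) , ¬f) → tw , ¬f , ¬a }) F₁))

  -- Completeness in both directions gives the P5 Q₂ - x₁ - Q₃ - x₂ - Q₁, whose ends are
  -- non-neighbours of x₂ and x₁ in their own members.
  fullLater⇒chain : ∀ {p C} c → Family {Item p} (Missing C) FullLater (inBound c) →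
                    Family (GoodItem C) Chain c
  fullLater⇒chain {C = C} c F
    with ramsey (λ (Q , _) (_ , x′) → full? x′ Q) 3 (ramseyBound c 3)
           (stable proj₂ (ramseyBound 3 (ramseyBound c 3)) F)
  ... | inj₁ F₁ = ⊥-elim (comatching (three F₁))
    where
    comatching : ¬ _
    comatching (_ , _ , _ , ((_ , s₁ , m₁) , (_ , s₂ , m₂) , _) ,
                (((tw₁₂ , f₁₂) , n₁₂) , f₂₁) , (((tw₁₃ , f₁₃) , _) , _) , (((tw₂₃ , f₂₃) , _) , _)) =
      p5 (~sym (f₁₂ s₂)) (f₁₃ zero) (~sym (f₂₃ zero)) (f₂₁ s₁)
         (proj₁ (proj₁ tw₂₃ s₂ zero)) (~sym m₂) (~sym (proj₁ (proj₁ tw₁₂ s₁ s₂)))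
         n₁₂ m₁ (~sym (proj₁ (proj₁ tw₁₃ s₁ zero)))
  ... | inj₂ F₁ =
    weaken proj₁ (λ { ((((tw , f) , n) , _) , a) → twin-sym tw , a , f , ~sym n })
      -- Reversal turns complete-to-later into complete-to-earlier, as `Chain` requires.
      (reverseFamily (forcePairs (λ (Q , _) (_ , x′) → anti? x′ Q) c 3
        (no-three-mixed proj₁ λ { ((((tw , _) , _) , ¬f) , ¬a) → tw , ¬f , ¬a }) F₁))

  -- Half graphs yield induced matchings.

  module _ {p : ℕ} {b : V} {C : List V} where

    Own : Item p → Set
    Own (Q , y) = Good (b ∷ C) Q × Full y Q

    Outer : Item p → Set
    Outer i = Own i × b ≁ proj₂ i

    toHub : ∀ {Q : Fin (suc p) → V} → Good (b ∷ C) Q → Full b Q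
    toHub g = All.head (complete g)

    -- Chain says nothing about x and its own Q; pairing the Q of one item with the x of the next
    -- item makes x complete to Q.
    own-chain : ∀ c → Family (GoodItem {p} (b ∷ C)) Chain (c + c) → Family Own Chain c
    own-chain c F =
      mapFamily (λ ((Q , _) , (_ , y)) _ → Q , y)
        (λ { (g , _ , _ , _ , full , _) → g , full })
        (λ { _ _ ((tw , _) , (_ , _ , full , _) , (_ , anti , _) , (_ , _ , _ , n)) →
             tw , anti , full , n })
        (thin c F)

    -- If three items had y adjacent to b, then y₂ - Q₁ - y₃ - Q₂ would be the rim of a W4 with hub
    -- b.
    outer-chain : ∀ c → Family Own Chain (c + 3) → Family Outer Chain c
    outer-chain c = force (λ (_ , y) → adj G b y Bool.≟ false) c 3 (no-inner ∘ three)
      where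
      no-inner : ¬ Σ (Item p) λ i₁ → Σ (Item p) λ i₂ → Σ (Item p) λ i₃ →
        ((Own i₁ × ¬ b ≁ proj₂ i₁) × (Own i₂ × ¬ b ≁ proj₂ i₂) × (Own i₃ × ¬ b ≁ proj₂ i₃)) ×
        Chain i₁ i₂ × Chain i₁ i₃ × Chain i₂ i₃
      no-inner (_ , _ , _ , (((g₁ , _) , _) , ((g₂ , f₂) , b₂) , ((_ , f₃) , b₃)) ,
                (tw₁₂ , _ , f₂₁ , _) , (_ , _ , f₃₁ , _) , (_ , a₂₃ , f₃₂ , n₂₃)) =
        noW4 W4-free (f₂₁ zero) (~sym (f₃₁ zero)) (f₃₂ zero) (~sym (f₂ zero)) n₂₃
          (proj₁ (proj₁ tw₁₂ zero zero))
          (λ e → separated (~sym (f₃ zero)) (~sym (a₂₃ zero)) (≡-sym e))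
          (proj₂ (proj₁ tw₁₂ zero zero))
          (¬-not b₂) (toHub g₁ zero) (¬-not b₃) (toHub g₂ zero)

    -- w is adjacent to y₁ and y₂ (else there is a P5 through b), and then b – Q₂ s₂ – y₂ – w – y₁ is a P5.
    outer-misses-one : ∀ {i₁ i₂ : Item p} {Q y w s₁ s₂ s} → Outer i₁ → Outer i₂ → Good (b ∷ C) Q →
      Chain i₁ i₂ → Chain i₁ (Q , y) → Chain i₂ (Q , y) → b ≁ w → w ∼ Q s →
      w ≁ proj₁ i₁ s₁ → w ≁ proj₁ i₂ s₂ → ⊥
    outer-misses-one {Q₁ , y₁} {Q₂ , y₂} {Q} {w = w} {s₁} {s₂} {s} ((g₁ , f₁) , b₁) ((g₂ , f₂) , b₂) g
      (tw₁₂ , a₁₂ , f₂₁ , n₁₂) (tw₁ , a₁ , _) (tw₂ , a₂ , _) bw ws w₁ w₂ =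
      p5 (toHub g₂ s₂) (~sym (f₂ s₂)) (~sym wy₂) wy₁ b₂ bw b₁ (~sym w₂) (~sym (a₁₂ s₂)) (~sym n₁₂)
      where
      adjacent : ∀ {y} → b ≁ y → y ∼ Q₁ s₁ → y ≁ Q s → w ∼ y
      adjacent {y} by ys₁ ys with adj G w y in eq
      ... | true  = refl
      ... | false = ⊥-elim (p5 ys₁ (~sym (toHub g₁ s₁)) (toHub g s) (~sym ws) (~sym by) ys
                      (~sym eq) (proj₁ (proj₁ tw₁ s₁ s)) (~sym w₁) bw)
      wy₁ : w ∼ y₁
      wy₁ = adjacent b₁ (f₁ s₁) (a₁ s)
      wy₂ : w ∼ y₂
      wy₂ = adjacent b₂ (f₂₁ s₁) (a₂ s)

    Separator : List (Item p) → (Fin (suc p) → V) → V → Set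
    Separator Ps Q w = (∀ s → Q s ≢ w) × (∃ λ s → w ∼ Q s) × b ∼ w ×
                       ∃ λ i → i ∈ Ps × ∃ λ t → w ≁ proj₁ i t

    -- Separators of Q from distinct items that are not adjacent to b are pairwise adjacent: each misses
    -- just one item.
    inner-separator : ∀ {Q y} (F : Family Outer Chain (suc K)) → Good (b ∷ C) Q →
                      All (λ i → Chain i (Q , y)) (elems F) →
                      ∃ λ w → Separator (elems F) Q w
    inner-separator {Q} {y} (family Ps le ps rs) g later =
      -- Of `suc K` separators one is adjacent to b, or K are not and form a clique.
      [ found , ⊥-elim ∘ all-outer ]′ (split (λ (_ , w) → adj G b w Bool.≟ true) 1 K separators)
      where
      Sep : Item p × V → Set
      Sep (i , w) = Outer i × i ∈ Ps × Chain i (Q , y) ×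
                    (∀ s → Q s ≢ w) × (∃ λ s → w ∼ Q s) × ∃ λ t → w ≁ proj₁ i t
      separate : ∀ {i} → Chain i (Q , y) →
                 ∃ λ x → ∃ λ t → (∀ s → Q s ≢ x) × x ∼ Q t × x ≁ proj₁ i t
      separate (tw , _) = distinguish (injective g) (twin-sym tw)
      separators : Family Sep (λ (i , _) (j , _) → Chain i j) (suc K)
      separators =
        mapFamily (λ i (_ , _ , ch) → i , proj₁ (separate ch))
          (λ (o , i∈ , ch) → let (_ , t , w∉ , e , f) = separate ch in
                             o , i∈ , ch , w∉ , (t , e) , (t , f))
          (λ _ _ ch → ch)
          (family Ps le (All.zip (ps , All.zip (All.tabulate id , later))) rs)
      found : Family (λ j → Sep j × b ∼ proj₂ j) _ 1 → ∃ λ w → Separator Ps Q w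
      found (family ((i , w) ∷ _) _ (((_ , i∈ , _ , w∉ , hit , miss) , bw) ∷ _) _) =
        w , w∉ , hit , bw , i , i∈ , miss
      all-outer : ¬ Family (λ j → Sep j × ¬ b ∼ proj₂ j) (λ (i , _) (j , _) → Chain i j) K
      all-outer F = no-clique-family {P = λ _ → ⊤} id id
        (mapFamily (λ (_ , w) _ → w) (λ _ → tt) clique F)
        where
        clique : ∀ {i j : Item p × V} → Sep i × ¬ b ∼ proj₂ i → Sep j × ¬ b ∼ proj₂ j →
                 Chain (proj₁ i) (proj₁ j) → proj₂ i ∼ proj₂ j
        clique {i , w} {i′ , w′} ((o , _ , ch , _ , (s , ws) , (t , wt)) , bw)
                                 ((o′ , _ , ch′ , _ , (s′ , ws′) , (t′ , wt′)) , bw′) r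
          with adj G w w′ in eq
        ... | true  = refl
        ... | false =
          -- The P5 is w - `proj₁ i′ t′` - b - `proj₁ i t` - w′.
          ⊥-elim (p5 wt′₁ (~sym (toHub (proj₁ (proj₁ o′)) t′)) (toHub (proj₁ (proj₁ o)) t) (~sym w′t)
                     (~sym (¬-not bw)) wt eq (~sym (proj₁ (proj₁ (proj₁ r) t t′))) (~sym wt′) (¬-not bw′))
          where
          wt′₁ : w ∼ proj₁ i′ t′
          wt′₁ with adj G w (proj₁ i′ t′) in eq′
          ... | true  = refl
          ... | false = ⊥-elim (outer-misses-one o o′ g r ch ch′ (¬-not bw) ws wt eq′)
          w′t : w′ ∼ proj₁ i t
          w′t with adj G w′ (proj₁ i t) in eq′
          ... | true  = refl
          ... | false = ⊥-elim (outer-misses-one o o′ g r ch ch′ (¬-not bw′) ws′ eq′ wt′)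

    -- If w is adjacent to y₂, then Q₁ - y₂ - Q₂ - b is the rim of a W4 with hub w. Otherwise a P5
    -- runs from the reference vertex missed by w through y₂, Q₁ and w to Q₃.
    separator-hits-two : ∀ {Ps Q w} {i₁ i₂ i₃ : Item p} {s₁ s₂ s₃} → Separator Ps Q w →
      Outer i₁ → Outer i₂ → Outer i₃ → All (λ i → Chain i i₁ × Chain i i₂ × Chain i i₃) Ps →
      Chain i₁ i₂ → Chain i₁ i₃ → Chain i₂ i₃ →
      w ∼ proj₁ i₁ s₁ → w ∼ proj₁ i₂ s₂ → w ∼ proj₁ i₃ s₃ → ⊥
    separator-hits-two {w = w} {Q₁ , y₁} {Q₂ , y₂} {Q₃ , y₃} {s₁} {s₂} {s₃}
      (_ , _ , bw , i , i∈ , t , wt) ((g₁ , f₁) , b₁) ((g₂ , f₂) , b₂) ((g₃ , _) , _) later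
      (tw₁₂ , a₁₂ , f₂₁ , n₁₂) (tw₁₃ , _) (_ , a₂₃ , _) h₁ h₂ h₃
      with All.lookup later i∈
    ... | (tw₁ , _) , (_ , _ , fᵢ , _) , (tw₃ , _) with adj G w y₂ in eq
    ...   | true  = noW4 W4-free (~sym (f₂₁ s₁)) (f₂ s₂) (~sym (toHub g₂ s₂)) (toHub g₁ s₁)
                      (proj₁ (proj₁ tw₁₂ s₁ s₂)) (~sym b₂) (proj₂ (proj₁ tw₁₂ s₁ s₂))
                      (λ e → separated (~sym (toHub g₃ s₃)) (~sym (a₂₃ s₃)) (≡-sym e))
                      h₁ eq h₂ (~sym bw)
    ...   | false = p5 (~sym (fᵢ t)) (f₂₁ s₁) (~sym h₁) h₃
                      (proj₁ (proj₁ tw₁ t s₁)) (~sym wt) (proj₁ (proj₁ tw₃ t s₃))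
                      (~sym eq) (a₂₃ s₃) (proj₁ (proj₁ tw₁₃ s₁ s₃))

    -- Each w meets at most two members, so no four items have the first w meeting all later members
    -- or the last w all earlier ones. Ramsey's theorem in both directions leaves a matching.
    separators⇒matching : ∀ Ps m →
      Family {Item p × V} (λ (i , w) → Outer i × All (λ j → Chain j i) Ps × Separator Ps (proj₁ i) w)
                          (λ (i , _) (j , _) → Chain i j) (hitBound m) →
      Family (Private {p} (b ∷ C)) Matching m
    separators⇒matching Ps m F =
      mapFamily (λ ((Q , _) , w) _ → Q , w)
        (λ { (((g , _) , _) , _ , w∉ , hit , _) → g , w∉ , hit })
        (λ { _ _ ((((tw , _) , a) , a′) , n) → tw , a , a′ , n })
        (stable proj₂ m
          (forcePairs (λ (i , _) (_ , w′) → anti? w′ (proj₁ i)) (ramseyBound m K) 4 (backward ∘ four)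
            (forcePairs (λ (_ , w) (i′ , _) → anti? w (proj₁ i′)) (ramseyBound (ramseyBound m K) 4) 4
              (forward ∘ four) F)))
      where
      P : Item p × V → Set
      P (i , w) = Outer i × All (λ j → Chain j i) Ps × Separator Ps (proj₁ i) w
      no-three-hits : ∀ {Q w i₁ i₂ i₃ w₁ w₂ w₃} → Separator Ps Q w →
        P (i₁ , w₁) → P (i₂ , w₂) → P (i₃ , w₃) → Chain i₁ i₂ → Chain i₁ i₃ → Chain i₂ i₃ →
        ¬ Anti w (proj₁ i₁) → ¬ Anti w (proj₁ i₂) → ¬ Anti w (proj₁ i₃) → ⊥
      no-three-hits sep (o₁ , l₁ , _) (o₂ , l₂ , _) (o₃ , l₃ , _) r₁₂ r₁₃ r₂₃ h₁ h₂ h₃ =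
        separator-hits-two sep o₁ o₂ o₃ (All.zip (l₁ , All.zip (l₂ , l₃))) r₁₂ r₁₃ r₂₃
          (proj₂ (¬anti⇒ h₁)) (proj₂ (¬anti⇒ h₂)) (proj₂ (¬anti⇒ h₃))
      forward : ¬ _
      forward (_ , _ , _ , _ , ((_ , _ , sep) , p₂ , p₃ , p₄) ,
               ((_ , h₂) , (_ , h₃) , (_ , h₄)) , (r₂₃ , _) , (r₂₄ , _) , (r₃₄ , _)) =
        no-three-hits sep p₂ p₃ p₄ r₂₃ r₂₄ r₃₄ h₂ h₃ h₄
      backward : ¬ _
      backward (_ , _ , _ , _ , (p₁ , p₂ , p₃ , (_ , _ , sep)) ,
                (((r₁₂ , _) , _) , ((r₁₃ , _) , _) , (_ , h₁)) , ((r₂₃ , _) , _) , (_ , h₂) , (_ , h₃)) =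
        no-three-hits sep p₁ p₂ p₃ r₁₂ r₁₃ r₂₃ h₁ h₂ h₃

    chain⇒matching : ∀ m → Family (GoodItem {p} (b ∷ C)) Chain (chainBound m) →
                     Family (Private {p} (b ∷ C)) Matching m
    chain⇒matching m F
      -- The initial items are the references from which all later members are separated.
      with chop (suc K) (hitBound m)
             (outer-chain (suc K + hitBound m) (own-chain (suc K + hitBound m + 3) F))
    ... | Ps , rest =
      separators⇒matching (elems Ps) m
        (mapFamily (λ i (((g , _) , _) , later) → i , proj₁ (inner-separator Ps g later))
          (λ (o , later) → o , later , proj₂ (inner-separator Ps (proj₁ (proj₁ o)) later))
          (λ _ _ r → r) rest)

    matching : ∀ m → Family (Good {suc p} (b ∷ C)) Twin (matchBound m) →
               Family (Private {p} (b ∷ C)) Matching m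
    matching m F =
      [ [ id , chain⇒matching m ]′ ∘ matching-or-chain m (chainBound m) ∘ mapPred proj₁
      , chain⇒matching m ∘ fullLater⇒chain (chainBound m) ∘ mapPred proj₁ ]′
      (triangular (λ _ → ⊤) (outBound m (chainBound m)) (inBound (chainBound m)) (mapPred (_, tt) F))

  -- Enlarging every member by one vertex.

  -- Two vertices xᵢ, xⱼ not adjacent to c give the P5 xᵢ – Qᵢ – c – Qⱼ – xⱼ.
  attach : ∀ {p C} Cs m {P : Item p → Set} → (∀ {i} → P i → Private C i) →
           (∀ {i} → P i → All (λ c → Full c (proj₁ i)) Cs) →
           Family P Matching (attachBound (length Cs) m) →
           Family (λ i → P i × All (_∼ proj₂ i) Cs) Matching m
  attach []       m priv compl F = mapPred (_, []) F
  attach {p} (c ∷ Cs) m {P} priv compl F =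
    mapPred (λ { ((q , e) , es) → q , e ∷ es })
      (attach Cs m (priv ∘ proj₁) (All.tail ∘ compl ∘ proj₁)
        (force (λ (_ , x) → adj G c x Bool.≟ true) (attachBound (length Cs) m) 2 (no-two ∘ two) F))
    where
    no-two : ¬ ∃₂ λ i j → (P i × ¬ c ∼ proj₂ i) × (P j × ¬ c ∼ proj₂ j) × Matching i j
    no-two (_ , _ , (p₁ , n₁) , (p₂ , n₂) , (tw , a₁₂ , a₂₁ , n)) with priv p₁ | priv p₂
    ... | _ , _ , s₁ , e₁ | _ , _ , s₂ , e₂ =
      p5 e₁ (~sym (All.head (compl p₁) s₁)) (All.head (compl p₂) s₂) (~sym e₂)
         (~sym (¬-not n₁)) (a₁₂ s₂) n (proj₁ (proj₁ tw s₁ s₂)) (~sym (a₂₁ s₁)) (¬-not n₂)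

  grow : ∀ {p b C} m → Family (Good {suc p} (b ∷ C)) Twin (growBound (length (b ∷ C)) p m) →
         Family (Good {suc (suc p)} (b ∷ C)) Twin m
  grow {p} {b} {C} m F = mapFamily (λ (Q , x) _ → x ◃ Q) extended twins (proj₂ uniform)
    where
    Attached : Item p → Set
    Attached (Q , x) = Private (b ∷ C) (Q , x) × All (_∼ x) (b ∷ C)
    M : ℕ
    M = power (suc p) m
    matched : Family (Private {p} (b ∷ C)) Matching (attachBound (length (b ∷ C)) M)
    matched = matching (attachBound (length (b ∷ C)) M) F
    attached : Family Attached Matching M
    attached = attach (b ∷ C) M {P = Private (b ∷ C)} id (complete ∘ proj₁) matched
    -- One of the 2^(p + 1) attachment patterns is kept, so that the enlarged members are again
    -- copies of one labelled graph.
    uniform : Σ (Fin (suc p) → Bool) λ v →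
              Family (λ i → Attached i × ∀ s → adj G (proj₂ i) (proj₁ i s) ≡ v s) Matching m
    uniform = uniformize {P = Attached} (λ i s → adj G (proj₂ i) (proj₁ i s)) m attached
    v : Fin (suc p) → Bool
    v = proj₁ uniform
    P : Item p → Set
    P (Q , x) = Attached (Q , x) × (∀ s → adj G x (Q s) ≡ v s)
    extended : ∀ {i} → P i → Good (b ∷ C) (proj₂ i ◃ proj₁ i)
    extended {Q , x} (((g , x∉ , s , e) , cs) , _) =
      good inj (connected-◃ (connected g) s e)
        (All.zipWith (λ { (full , e′) → λ { zero → e′ ; (suc t) → full t } }) (complete g , cs))
      where
      inj : Injective _≡_ _≡_ (x ◃ Q)
      inj {zero}  {zero}  _  = refl
      inj {zero}  {suc t} eq = contradiction (≡-sym eq) (x∉ t)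
      inj {suc t} {zero}  eq = contradiction eq (x∉ t)
      inj {suc s} {suc t} eq = cong suc (injective g eq)
    twins : ∀ {i j} → P i → P j → Matching i j → Twin (proj₂ i ◃ proj₁ i) (proj₂ j ◃ proj₁ j)
    twins {Q , x} {Q′ , x′} (((_ , _ , s , e) , _) , v≡) (((_ , _ , s′ , e′) , _) , v≡′)
          ((dis , copy) , a , a′ , n) =
      disjoint , copies
      where
      disjoint : Disjoint (x ◃ Q) (x′ ◃ Q′)
      disjoint zero    zero    = n , separated (~sym e) (~sym (a′ s))
      disjoint zero    (suc t) = a t , separated (~sym e) (proj₁ (dis s t))
      disjoint (suc t) zero    = ~sym (a′ t) ,
        λ eq → separated (~sym e′) (~sym (proj₁ (dis t s′))) (≡-sym eq)
      disjoint (suc t) (suc u) = dis t u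
      copies : ∀ t u → adj G ((x ◃ Q) t) ((x ◃ Q) u) ≡ adj G ((x′ ◃ Q′) t) ((x′ ◃ Q′) u)
      copies zero    zero    = trans (irrefl G x) (≡-sym (irrefl G x′))
      copies zero    (suc u) = trans (v≡ u) (≡-sym (v≡′ u))
      copies (suc t) zero    = trans (~sym (v≡ t)) (≡-sym (~sym (v≡′ t)))
      copies (suc t) (suc u) = copy t u

  -- Balls in connected P5-free graphs.

  neighbours : ∀ {p} → (Fin p → V) → Fin p → List (Fin p)
  neighbours {p} Q s = filter (λ t → adj G (Q s) (Q t) Bool.≟ true) (allFin p)

  module Ball {p : ℕ} (Q : Fin p → V) (s₀ : Fin p) where

    next : List (Fin p) → List (Fin p)
    next = concatMap (neighbours Q)

    -- The lists may contain repetitions; their lengths serve as upper bounds only.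
    level₁ level₂ level₃ ball : List (Fin p)
    level₁ = neighbours Q s₀
    level₂ = next level₁
    level₃ = next level₂
    ball   = [ s₀ ] ++ (level₁ ++ (level₂ ++ level₃))

    ∈-neighbours : ∀ {s t} → Q s ∼ Q t → t ∈ neighbours Q s
    ∈-neighbours = ∈-filter⁺ _ (∈-allFin _)

    neighbours-∼ : ∀ {s t} → t ∈ neighbours Q s → Q s ∼ Q t
    neighbours-∼ = proj₂ ∘ ∈-filter⁻ _ {xs = allFin p}

    ∈-next : ∀ {s t} l → s ∈ l → Q s ∼ Q t → t ∈ next l
    ∈-next l s∈ e = ∈-concatMap⁺ (neighbours Q) (Any.map (λ { refl → ∈-neighbours e }) s∈)

    next-∈ : ∀ {t} l → t ∈ next l → ∃ λ s → s ∈ l × Q s ∼ Q t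
    next-∈ l t∈ with find (∈-concatMap⁻ (neighbours Q) {xs = l} t∈)
    ... | s , s∈ , t∈′ = s , s∈ , neighbours-∼ t∈′

    in₁ : ∀ {t} → t ∈ level₁ → t ∈ ball
    in₁ = there ∘ ∈-++⁺ˡ
    in₂ : ∀ {t} → t ∈ level₂ → t ∈ ball
    in₂ = there ∘ ∈-++⁺ʳ level₁ ∘ ∈-++⁺ˡ
    in₃ : ∀ {t} → t ∈ level₃ → t ∈ ball
    in₃ = there ∘ ∈-++⁺ʳ level₁ ∘ ∈-++⁺ʳ level₂

    -- A shortest path with four edges would be an induced P5.
    beyond₃ : ∀ {t u} → t ∈ level₃ → Q t ∼ Q u → u ∈ ball
    beyond₃ {t} {u} t∈ tu with next-∈ level₂ t∈
    ... | r , r∈ , rt with next-∈ level₁ r∈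
    ...   | q , q∈ , qr
      with adj G (Q s₀) (Q r) in s₀r | adj G (Q s₀) (Q t) in s₀t | adj G (Q q) (Q t) in qt
         | adj G (Q s₀) (Q u) in s₀u | adj G (Q q) (Q u) in qu | adj G (Q r) (Q u) in ru
    ...     | true  | _     | _     | _     | _     | _     =
      in₃ (∈-next level₂ (∈-next level₁ (∈-neighbours s₀r) rt) tu)
    ...     | false | true  | _     | _     | _     | _     = in₂ (∈-next level₁ (∈-neighbours s₀t) tu)
    ...     | false | false | true  | _     | _     | _     = in₃ (∈-next level₂ (∈-next level₁ q∈ qt) tu)
    ...     | false | false | false | true  | _     | _     = in₁ (∈-neighbours s₀u)
    ...     | false | false | false | false | true  | _     = in₂ (∈-next level₁ q∈ qu)
    ...     | false | false | false | false | false | true  = in₃ (∈-next level₂ r∈ ru)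
    ...     | false | false | false | false | false | false =
      ⊥-elim (p5 (neighbours-∼ q∈) qr rt tu s₀r s₀t s₀u qt qu ru)

    ball-closed : ∀ s t → Q s ∼ Q t → s ∈ ball → t ∈ ball
    ball-closed s t e (here refl) = in₁ (∈-neighbours e)
    ball-closed s t e (there s∈) with ∈-++⁻ level₁ s∈
    ... | inj₁ s∈₁ = in₂ (∈-next level₁ s∈₁ e)
    ... | inj₂ s∈′ with ∈-++⁻ level₂ s∈′
    ...   | inj₁ s∈₂ = in₃ (∈-next level₂ s∈₂ e)
    ...   | inj₂ s∈₃ = beyond₃ s∈₃ e

    all-in-ball : Connected Q → ∀ t → t ∈ ball
    all-in-ball con t =
      does-true (t ∈? ball)
        (con (λ t → does (t ∈? ball))
          (λ s t e s∈ → dec-true (t ∈? ball) (ball-closed s t e (does-true (s ∈? ball) s∈)))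
          s₀ (dec-true (s₀ ∈? ball) (here refl)) t)
      where
      open DecMembership _≟_ using (_∈?_)
      does-true : {X : Set} (x? : Dec X) → does x? ≡ true → X
      does-true (yes x) _ = x

    length-next : ∀ {D} → (∀ s → length (neighbours Q s) ≤ D) → ∀ l → length (next l) ≤ length l * D
    length-next h []      = z≤n
    length-next h (s ∷ l) = ≤-trans (≤-reflexive (length-++ (neighbours Q s)))
                              (+-mono-≤ (h s) (length-next h l))

    length-ball : ∀ {D} → (∀ s → length (neighbours Q s) ≤ D) → length ball ≤ ballBound D
    length-ball {D} h = s≤s (≤-trans (≤-reflexive (trans (length-++ level₁)
        (cong (length level₁ +_) (length-++ level₂))))
      (+-mono-≤ (h s₀) (+-mono-≤ le₂ (≤-trans (length-next h level₂) (*-monoˡ-≤ D le₂)))))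
      where
      le₂ : length level₂ ≤ D * D
      le₂ = ≤-trans (length-next h level₁) (*-monoˡ-≤ D (h s₀))

  -- Sending each t to its position in the list is injective.
  covering⇒≤ : ∀ {p} (l : List (Fin p)) → (∀ t → t ∈ l) → p ≤ length l
  covering⇒≤ l t∈ = injective⇒≤ {f = λ t → index (t∈ t)} λ {s} {t} eq →
    trans (Any.lookup-index (t∈ s)) (trans (cong (lookup l) eq) (≡-sym (Any.lookup-index (t∈ t))))

  -- If all degrees were below D, a ball of radius three would cover Q and be too small.
  star : ∀ {p} (Q : Fin p → V) → Connected Q → ∀ D → ballBound D < p →
         ∃ λ s → Family (λ t → Q s ∼ Q t) _≢_ D
  star {suc p} Q con D big with any? (λ s → D ≤? length (neighbours Q s))
  ... | yes (s , le) = s , family (neighbours Q s) le (All.tabulate (Ball.neighbours-∼ Q zero))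
                             (filter⁺ (λ t → adj G (Q s) (Q t) Bool.≟ true) (allFin⁺ (suc p)))
  ... | no small = ⊥-elim (<-irrefl refl (<-≤-trans big (≤-trans
          (covering⇒≤ (Ball.ball Q zero) (Ball.all-in-ball Q zero con))
          (Ball.length-ball Q zero λ s → <⇒≤ (≰⇒> λ le → small (s , le))))))

  -- Induction over cliques.

  grow-many : ∀ {b C} j p →
              Family (Good {suc p} (b ∷ C)) Twin (familyBound (length (b ∷ C)) j p) →
              ∃ λ q → j + p < q × Σ (Fin q → V) (Good (b ∷ C))
  grow-many zero    p (family (Q ∷ _) _ (g ∷ _) _) = suc p , ≤-refl , Q , g
  grow-many {b} {C} (suc j) p F =
    let q , lt , found = grow-many {b} {C} j (suc p) (grow (familyBound (length (b ∷ C)) j (suc p)) F)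
    in  q , subst (_< q) (+-suc j p) lt , found

  bounded : ∀ f {p} C (Q : Fin p → V) → f + length C ≡ K → AllPairs _∼_ C → Good C Q →
            p ≤ sizeBound f (length C)
  bounded zero C Q eq clique g = ⊥-elim (no-clique C (≤-reflexive (≡-sym eq)) clique)
  bounded (suc f) {p} C Q eq clique g = ≮⇒≥ λ big →
    let σ = star Q (connected g) D big
    -- Growing singletons M times gives a member with more than M vertices, which contradicts the
    -- bound for `Q s ∷ C`.
    in  too-big (proj₁ σ) (grow-many {Q (proj₁ σ)} {C} M 0 (singletons σ))
    where
    M D₁ D : ℕ
    M  = sizeBound f (suc (length C))
    D₁ = familyBound (suc (length C)) M 0
    D  = ramseyBound D₁ K
    singletons : (σ : ∃ λ s → Family (λ t → Q s ∼ Q t) _≢_ D) →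
                 Family (Good {1} (Q (proj₁ σ) ∷ C)) Twin D₁
    singletons (s , F) =
      mapFamily (λ t _ _ → Q t)
        (λ {t} e → good (λ { {zero} {zero} _ → refl })
                     (λ { P _ zero Ps zero → Ps })
                     ((λ _ → e) ∷ All.map (λ full _ → full t) (complete g)))
        (λ { {t} {u} _ _ (ne , n) → (λ _ _ → n , ne ∘ injective g) ,
                                    λ _ _ → trans (irrefl G (Q t)) (≡-sym (irrefl G (Q u))) })
        (stable Q D₁ F)
    too-big : ∀ s → ¬ ∃ λ q → M + 0 < q × Σ (Fin q → V) (Good (Q s ∷ C))
    too-big s (q , lt , Q′ , g′) =
      <-irrefl refl (<-≤-trans lt (≤-trans
        (bounded f (Q s ∷ C) Q′ (trans (+-suc f (length C)) eq)
          (All.map (λ full → ~sym (full s)) (complete g) ∷ clique) g′)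
        (m≤m+n M 0)))

  -- If P separated s from t, the colouring omitting t, used on P, and the one omitting s, used
  -- elsewhere, would together colour G.
  connected-id : Connected {n} id
  connected-id P closed s Ps t with P t in Pt
  ... | true  = refl
  ... | false = ⊥-elim (uncolourable c bound proper)
    where
    module S = ColouringOff (colouring-off s)
    module T = ColouringOff (colouring-off t)
    clash : ∀ {u v} → P u ≡ true → P v ≡ false → u ≢ v
    clash Pu Pv refl with trans (≡-sym Pu) Pv
    ... | ()
    c : V → ℕ
    c u = if P u then T.colour u else S.colour u
    bound : ∀ u → c u < k
    bound u with P u in Pu
    ... | true  = T.bound (clash Pu Pt)
    ... | false = S.bound λ e → clash Ps Pu (≡-sym e)
    proper : ∀ {u w} → u ∼ w → c u ≢ c w
    proper {u} {w} e with P u in Pu | P w in Pw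
    ... | true  | true  = T.proper (clash Pu Pt) (clash Pw Pt) e
    ... | false | false = S.proper (λ e → clash Ps Pu (≡-sym e)) (λ e → clash Ps Pw (≡-sym e)) e
    ... | true  | false = contradiction refl (clash (closed u w e Pu) Pw)
    ... | false | true  = contradiction refl (clash (closed w u (~sym e) Pw) Pu)

  order-bounded : n ≤ sizeBound K 0
  order-bounded = bounded K [] id (+-comm K 0) [] (good id connected-id [])

-- Vertex-critical graphs have bounded order.

order-of-critical : ∀ k (G : AnyGraph) → VertexCritical (suc k) G → P5W4Free G →
                    proj₁ G ≤ Bounds.sizeBound k (suc (suc k)) 0
order-of-critical k (zero  , G) _ _ = z≤n
order-of-critical k (suc n , G) (((c , proper) , minimal) , deletable) (p5-free , w4-free) =
  Growth.order-bounded {G = G} record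
    { P5-free       = p5-free
    ; W4-free       = w4-free
    ; no-clique     = λ xs le clique → 1+n≰n (≤-trans le (injective⇒≤ (colours-distinct xs clique)))
    ; colouring-off = colouring-off
    ; uncolourable  = λ c′ bound proper′ → 1+n≰n (minimal k
        ((λ u → fromℕ< (bound u)) , λ u w e eq →
          proper′ {u} {w} e (fromℕ<-injective _ _ (bound u) (bound w) eq)))
    }
  where
  open Adjacency G
  colours-distinct : ∀ xs → AllPairs _∼_ xs → Injective _≡_ _≡_ (c ∘ lookup xs)
  colours-distinct (x ∷ xs) (r ∷ rs) {zero}  {zero}  eq = refl
  colours-distinct (x ∷ xs) (r ∷ rs) {zero}  {suc j} eq =
    contradiction eq (proper _ _ (All.lookup r (∈-lookup j)))
  colours-distinct (x ∷ xs) (r ∷ rs) {suc i} {zero}  eq =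
    contradiction (≡-sym eq) (proper _ _ (All.lookup r (∈-lookup i)))
  colours-distinct (x ∷ xs) (r ∷ rs) {suc i} {suc j} eq = cong suc (colours-distinct xs rs eq)

  colouring-off : ∀ v → ColouringOff k v
  colouring-off v with deletable v
  ... | j , s≤s j≤k , (d , d-proper) , _ = record { colour = c′ ; bound = bound ; proper = proper′ }
    where
    c′ : Fin (suc n) → ℕ
    c′ u with v ≟ u
    -- A placeholder for the omitted vertex.
    ... | yes _  = 0
    ... | no v≢u = toℕ (d (punchOut v≢u))
    bound : ∀ {u} → u ≢ v → c′ u < k
    bound {u} u≢v with v ≟ u
    ... | yes e = contradiction (≡-sym e) u≢v
    ... | no ne = <-≤-trans (toℕ<n (d (punchOut ne))) j≤k
    proper′ : ∀ {u w} → u ≢ v → w ≢ v → u ∼ w → c′ u ≢ c′ w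
    proper′ {u} {w} u≢v w≢v e with v ≟ u | v ≟ w
    ... | yes e′ | _ = contradiction (≡-sym e′) u≢v
    ... | no _ | yes e′ = contradiction (≡-sym e′) w≢v
    ... | no v≢u | no v≢w = λ eq → d-proper (punchOut v≢u) (punchOut v≢w)
            (trans (cong₂ (adj G) (punchIn-punchOut v≢u) (punchIn-punchOut v≢w)) e)
            (toℕ-injective eq)

-- Enumeration of the graphs of bounded order.

functions : List A → ∀ q → List (Fin q → A)
functions xs zero    = [ (λ ()) ]
functions xs (suc q) = cartesianProductWith (λ a f → λ { zero → a ; (suc i) → f i }) xs (functions xs q)

-- The general `R` allows nesting: the rows of an adjacency matrix are matched by pointwise
-- equality.
functions-complete : {R : B → A → Set} {xs : List A} → ∀ q (f : Fin q → B) → (∀ i → Any (R (f i)) xs) →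
                     Any (λ g → ∀ i → R (f i) (g i)) (functions xs q)
functions-complete         zero    f h = here λ ()
functions-complete {R = R} (suc q) f h =
  Any.cartesianProductWith⁺ _ (λ r rs → λ { zero → r ; (suc i) → rs i })
    (h zero) (functions-complete {R = R} q (f ∘ suc) (h ∘ suc))

-- Makes a graph of any Boolean matrix, so that all matrices can be listed; adjacency matrices keep
-- their entries.
symmetrize : ∀ {n} → (Fin n → Fin n → Bool) → Graph n
symmetrize {n} g = record
  { adj    = λ i j → h i j ∨ h j i
  ; sym    = λ i j → Bool.∨-comm (h i j) (h j i)
  ; irrefl = λ i → trans (Bool.∨-idem (h i i)) (h-irrefl i)
  }
  where
  h : Fin n → Fin n → Bool
  h i j = g i j ∧ not (does (i ≟ j))
  h-irrefl : ∀ i → h i i ≡ false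
  h-irrefl i = trans (cong (λ b → g i i ∧ not b) (dec-true (i ≟ i) refl)) (Bool.∧-zeroʳ (g i i))

symmetrize-adj : ∀ {n} (G : Graph n) {g} → (∀ i j → adj G i j ≡ g i j) →
                 ∀ i j → adj G i j ≡ adj (symmetrize g) i j
symmetrize-adj G {g} eq i j =
  trans (≡-sym (Bool.∨-idem (adj G i j)))
    (cong₂ _∨_ (part i j) (trans (sym G i j) (part j i)))
  where
  part : ∀ i j → adj G i j ≡ g i j ∧ not (does (i ≟ j))
  part i j with i ≟ j
  ... | yes refl = trans (irrefl G i) (≡-sym (Bool.∧-zeroʳ (g i i)))
  ... | no _     = trans (eq i j) (≡-sym (Bool.∧-identityʳ (g i j)))

graphs : ∀ n → List (Graph n)
graphs n = map symmetrize (functions (functions (true ∷ false ∷ []) n) n)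

graphs-complete : ∀ {n} (G : Graph n) → Any (Isomorphic G) (graphs n)
graphs-complete {n} G =
  Any.map⁺ (Any.map (λ eq → ↔-id _ , symmetrize-adj G eq)
    (functions-complete {R = λ f g → ∀ j → f j ≡ g j} n (adj G)
      λ i → functions-complete {R = _≡_} n (adj G i) λ j → bool (adj G i j)))
  where
  bool : ∀ b → b ∈ true ∷ false ∷ []
  bool true  = here refl
  bool false = there (here refl)

theorem1p1 : (k : ℕ) → k ≥ 1 →
    FinitelyManyUpToIso (λ G → VertexCritical k G × P5W4Free G)
-- `upTo` excludes its bound, and the order may equal `N`.
theorem1p1 (suc k) _ = concatMap graphsOn (upTo (suc N)) , listed
  where
  N : ℕ
  N = Bounds.sizeBound k (suc (suc k)) 0
  graphsOn : ℕ → List AnyGraph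
  graphsOn n = map (n ,_) (graphs n)
  graphsOn-complete : ∀ {n m} (G : Graph n) → n ≡ m → Any (IsoAny (n , G)) (graphsOn m)
  graphsOn-complete G refl = Any.map⁺ (graphs-complete G)
  listed : ∀ G → VertexCritical (suc k) G × P5W4Free G →
           Any (IsoAny G) (concatMap graphsOn (upTo (suc N)))
  listed (n , G) (critical , free) =
    Any.concat⁺ (Any.map⁺ (Any.map (graphsOn-complete G)
      (∈-upTo⁺ (s≤s (order-of-critical k (n , G) critical free)))))
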